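{- Let $q \neq 2$ be a prime power, let $n \geq 1$ be an integer, and let $W$ be the $n$-dimensional affine space over the finite field $\mathbb{F}_q$. Let $A_1,\ldots,A_m$ and $B_1,\ldots,B_m$ be affine subspaces of $W$ such that $A_i \cap B_i = \emptyset$ for each $1 \leq i \leq m$, and $A_i \cap B_j \neq \emptyset$ whenever $1 \leq i < j \leq m$. Then $m \leq q^n + 1$.
   Context: An affine subspace of $W = \mathbb{F}_q^n$ is a translate $v + U$ of a linear subspace $U$ of $\mathbb{F}_q^n$. -}

module Defs where

open import Algebra.Bundles using (CommutativeRing)
open import Data.Fin.Base using (Fin)
open import Data.Nat.Base using (ℕ; _^_; _≤_)
open import Data.Nat.Primality using (Prime)
open import Data.Product.Base using (∃; ∃-syntax; _×_)
open import Data.Vec.Functional using (Vector; zipWith; map; replicate)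
open import Data.Vec.Functional.Relation.Binary.Pointwise using (Pointwise)
open import Function.Bundles using (Inverse)
open import Level using (Level; suc; _⊔_)
open import Relation.Binary.Core using (Rel)
open import Relation.Binary.PropositionalEquality using (_≡_; setoid)
open import Relation.Nullary.Negation using (¬_)
open import Relation.Unary using (Pred; _∈_)

PrimePower : ℕ → Set
PrimePower q = ∃[ p ] ∃[ k ] Prime p × 1 ≤ k × q ≡ p ^ k

-- A field with exactly q elements, counted up to the ring's setoid equality.
record FiniteField (c ℓ : Level) (q : ℕ) : Set (suc (c ⊔ ℓ)) where
  field
    commutativeRing : CommutativeRing c ℓ

  open CommutativeRing commutativeRing public renaming (setoid to ≈-setoid)

  field
    1≉0         : ¬ 1# ≈ 0#
    inverse     : ∀ x → ¬ x ≈ 0# → ∃ λ y → x * y ≈ 1#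
    enumeration : Inverse ≈-setoid (setoid (Fin q))

module AffineGeometry {c ℓ : Level} {q : ℕ} (F : FiniteField c ℓ q) (n : ℕ) where

  open FiniteField F

  Point : Set c
  Point = Vector Carrier n

  infix  4 _≈ᵥ_
  infixl 6 _+ᵥ_
  infixr 7 _·ᵥ_

  _≈ᵥ_ : Rel Point ℓ
  _≈ᵥ_ = Pointwise _≈_

  0ᵥ : Point
  0ᵥ = replicate n 0#

  _+ᵥ_ : Point → Point → Point
  _+ᵥ_ = zipWith _+_

  _·ᵥ_ : Carrier → Point → Point
  a ·ᵥ u = map (a *_) u

  record LinearSubspace (p : Level) : Set (c ⊔ ℓ ⊔ suc p) where
    field
      vectors  : Pred Point p
      resp     : ∀ {u v} → u ≈ᵥ v → u ∈ vectors → v ∈ vectors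
      0-closed : 0ᵥ ∈ vectors
      +-closed : ∀ {u v} → u ∈ vectors → v ∈ vectors → u +ᵥ v ∈ vectors
      ·-closed : ∀ a {u} → u ∈ vectors → a ·ᵥ u ∈ vectors

  -- The translate v + U; it always contains v, so it is never empty.
  record AffineSubspace (p : Level) : Set (c ⊔ ℓ ⊔ suc p) where
    field
      base      : Point
      direction : LinearSubspace p

    points : Pred Point (c ⊔ ℓ ⊔ p)
    points w = ∃ λ u → u ∈ LinearSubspace.vectors direction × w ≈ᵥ base +ᵥ u

  open AffineSubspace public using (points)

{-# OPTIONS --safe #-}

-- A nonempty intersection of affine subspaces over F_q has q^d ≡ 1 (mod r)
-- points, where r = q − 1.  So modulo r the m × m matrix N with entries
-- |A_i ∩ B_j| has zero diagonal and ones above it, and hence N minus the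
-- all-ones matrix is triangular with unit diagonal.  It factors through
-- (ℤ/r)^(q^n + 1), because Σ_i e_i |A_i ∩ B_j| is determined by the values
-- Σ_i e_i [x ∈ A_i] for x ∈ W.  Thus (ℤ/r)^m injects into (ℤ/r)^(q^n + 1),
-- and since r ≥ 2 the pigeonhole principle gives m ≤ q^n + 1.
module Submission where

open import Defs
open import Algebra.Properties.AbelianGroup using (xyx⁻¹≈y)
open import Algebra.Properties.Ring using (+-cancelˡ; -1*x≈-x)
open import Data.Bool.Base using (if_then_else_; true; false)
open import Data.Fin.Base using (Fin; zero; suc; toℕ; fromℕ<; punchIn; combine; finToFun; funToFin) renaming (_<_ to _<ᶠ_)
open import Data.Fin.Induction using (>-wellFounded)
open import Data.Fin.Properties using (toℕ-injective; toℕ<n; fromℕ<-injective; punchInᵢ≢i; <-cmp; injective⇒≤; sequence; finToFun-funToFin; funToFin-finToFin)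
open import Data.Integer.Base as ℤ using (ℤ; +_; 0ℤ; 1ℤ; -1ℤ)
open import Data.Integer.Divisibility.Signed as ℤ using (_∣_; divides)
open import Data.Integer.DivMod using (_%ℕ_; _/ℕ_; n%ℕd<d; a≡a%ℕn+[a/ℕn]*n)
import Data.Integer.Properties as ℤ
open import Data.Integer.Tactic.RingSolver using (solve-∀)
open import Data.Nat.Base using (ℕ; zero; suc; _+_; _^_; _≤_; _<_; NonZero; z<s; s<s)
import Data.Nat.Base as ℕ
open import Data.Nat.Divisibility using (∣⇒≤)
import Data.Nat.Properties as ℕ
open import Data.Product.Base using (_×_; _,_; proj₁; proj₂)
open import Data.Vec.Functional using (Vector; []; _∷_; map; replicate)
open import Data.Vec.Functional.Relation.Binary.Pointwise using (Pointwise)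
open import Data.Product.Function.NonDependent.Propositional using (_×-⇔_)
open import Effect.Monad using (RawMonad)
open import Function.Base using (_∘_; const)
open import Function.Bundles using (Inverse; _⇔_; mk⇔)
open import Function.Construct.Composition using () renaming (inverse to _⨾_)
open import Function.Construct.Symmetry using () renaming (inverse to flip)
open import Induction.WellFounded using (Acc; acc)
open import Level using (Level)
open import Relation.Binary.Definitions using (tri<; tri≈; tri>)
open import Relation.Binary.PropositionalEquality using (_≡_; _≢_; _≗_; refl; sym; trans; cong; cong₂; subst; module ≡-Reasoning)
open import Relation.Nullary.Decidable using (Dec; does; map′; _×-dec_; dec-true; dec-false; does-⇔; decidable-stable; ¬¬-excluded-middle)
open import Relation.Nullary.Negation using (¬_; contradiction; ¬¬-Monad)
open import Relation.Unary using (Empty; Satisfiable; _∩_)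

open import Algebra.Properties.Semiring.Sum ℤ.+-*-semiring using (sum; sum-syntax; sum-cong-≗; sum-remove; sum-permute; ∑-distrib-+; ∑-comm; *-distribˡ-sum; *-distribʳ-sum)

-- Integer congruences and residues.

∣-sum : ∀ {d n} (f : Vector ℤ n) → (∀ i → d ∣ f i) → d ∣ sum f
∣-sum {n = zero}  f d∣f = divides 0ℤ refl
∣-sum {n = suc n} f d∣f = ℤ.∣m∣n⇒∣m+n (d∣f zero) (∣-sum (f ∘ suc) (d∣f ∘ suc))

sum-const : ∀ n x → sum {n} (const x) ≡ + n ℤ.* x
sum-const zero    x = sym (ℤ.*-zeroˡ x)
sum-const (suc n) x = trans (cong (ℤ._+_ x) (sum-const n x)) (sym (ℤ.suc-* (+ n) x))

%ℕ-≡⇒∣- : ∀ r .{{_ : NonZero r}} i j → i %ℕ r ≡ j %ℕ r → + r ∣ i ℤ.- j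
%ℕ-≡⇒∣- r i j eq = divides (i /ℕ r ℤ.- j /ℕ r) (begin
  i ℤ.- j
    ≡⟨ cong₂ ℤ._-_ (a≡a%ℕn+[a/ℕn]*n i r) (a≡a%ℕn+[a/ℕn]*n j r) ⟩
  (+ (i %ℕ r) ℤ.+ i /ℕ r ℤ.* + r) ℤ.- (+ (j %ℕ r) ℤ.+ j /ℕ r ℤ.* + r)
    ≡⟨ cong (λ k → (+ k ℤ.+ i /ℕ r ℤ.* + r) ℤ.- (+ (j %ℕ r) ℤ.+ j /ℕ r ℤ.* + r)) eq ⟩
  (+ (j %ℕ r) ℤ.+ i /ℕ r ℤ.* + r) ℤ.- (+ (j %ℕ r) ℤ.+ j /ℕ r ℤ.* + r)
    ≡⟨ cancel (+ (j %ℕ r)) (i /ℕ r) (j /ℕ r) (+ r) ⟩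
  (i /ℕ r ℤ.- j /ℕ r) ℤ.* + r ∎)
  where
  open ≡-Reasoning
  cancel : ∀ k x y z → (k ℤ.+ x ℤ.* z) ℤ.- (k ℤ.+ y ℤ.* z) ≡ (x ℤ.- y) ℤ.* z
  cancel = solve-∀

-- Both values lie in [0, r), so their difference is smaller than r in absolute value, and the only
-- such multiple of r is 0.
∣toℕ-toℕ⇒≡ : ∀ {r} (a b : Fin r) → + r ∣ + toℕ a ℤ.- + toℕ b → a ≡ b
∣toℕ-toℕ⇒≡ {r} a b r∣a-b with ℤ.∣ + toℕ a ℤ.- + toℕ b ∣ in eq | ℤ.∣⇒∣ᵤ r∣a-b
... | zero  | _     = toℕ-injective (ℤ.+-injective (ℤ.i-j≡0⇒i≡j _ _ (ℤ.∣i∣≡0⇒i≡0 eq)))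
... | suc k | r∣1+k = contradiction (∣⇒≤ r∣1+k) (ℕ.<⇒≱ (subst (_< r) eq small))
  where
  open ℕ.≤-Reasoning
  small : ℤ.∣ + toℕ a ℤ.- + toℕ b ∣ < r
  small = begin-strict
    ℤ.∣ + toℕ a ℤ.- + toℕ b ∣  ≡⟨ cong ℤ.∣_∣ (ℤ.m-n≡m⊖n (toℕ a) (toℕ b)) ⟩
    ℤ.∣ toℕ a ℤ.⊖ toℕ b ∣      ≤⟨ ℤ.∣m⊝n∣≤m⊔n (toℕ a) (toℕ b) ⟩
    toℕ a ℕ.⊔ toℕ b            <⟨ ℕ.⊔-lub (toℕ<n a) (toℕ<n b) ⟩
    r                          ∎

-- Pigeonhole and linear algebra modulo r.

funToFin-cong : ∀ {m n} {f g : Fin m → Fin n} → f ≗ g → funToFin f ≡ funToFin g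
funToFin-cong {zero}  f≗g = refl
funToFin-cong {suc m} f≗g = cong₂ combine (f≗g zero) (funToFin-cong (f≗g ∘ suc))

finToFun-injective : ∀ {m n} (x y : Fin (n ^ m)) → finToFun {n} {m} x ≗ finToFun y → x ≡ y
finToFun-injective {m} {n} x y eq = begin
  x                              ≡⟨ funToFin-finToFin {m} {n} x ⟨
  funToFin (finToFun {n} {m} x)  ≡⟨ funToFin-cong eq ⟩
  funToFin (finToFun {n} {m} y)  ≡⟨ funToFin-finToFin {m} {n} y ⟩
  y                              ∎
  where open ≡-Reasoning

-- Counting residue vectors replaces the rank–nullity theorem, so that r need
-- not be prime.
trivialKernel⇒≤ : ∀ {k m} r .{{_ : NonZero r}} → 1 < r → (X : Fin k → Fin m → ℤ) →
  (∀ e → (∀ x → + r ∣ ∑[ i < m ] (e i ℤ.* X x i)) → ∀ i → + r ∣ e i) →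
  m ≤ k
trivialKernel⇒≤ {k} {m} r 1<r X trivial =
  ℕ.≮⇒≥ λ k<m → ℕ.<⇒≱ (ℕ.^-monoʳ-< r 1<r k<m) (injective⇒≤ residues-injective)
  where
  -- An index below `r ^ m` is read as its m digits in base r.
  coefficient : Fin (r ^ m) → Fin m → ℤ
  coefficient c i = + toℕ (finToFun {r} {m} c i)

  value : Fin (r ^ m) → Fin k → ℤ
  value c x = ∑[ i < m ] (coefficient c i ℤ.* X x i)

  residue : Fin (r ^ m) → Fin k → Fin r
  residue c x = fromℕ< (n%ℕd<d (value c x) r)

  residues : Fin (r ^ m) → Fin (r ^ k)
  residues = funToFin ∘ residue

  value-diff : ∀ c d x →
    ∑[ i < m ] ((coefficient c i ℤ.- coefficient d i) ℤ.* X x i) ≡ value c x ℤ.- value d x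
  value-diff c d x = begin
    ∑[ i < m ] ((coefficient c i ℤ.- coefficient d i) ℤ.* X x i)
      ≡⟨ sum-cong-≗ (λ i → expand (coefficient c i) (coefficient d i) (X x i)) ⟩
    ∑[ i < m ] (coefficient c i ℤ.* X x i ℤ.+ -1ℤ ℤ.* (coefficient d i ℤ.* X x i))
      ≡⟨ ∑-distrib-+ (λ i → coefficient c i ℤ.* X x i) _ ⟩
    value c x ℤ.+ ∑[ i < m ] (-1ℤ ℤ.* (coefficient d i ℤ.* X x i))
      ≡⟨ cong (ℤ._+_ (value c x)) (*-distribˡ-sum -1ℤ (λ i → coefficient d i ℤ.* X x i)) ⟨
    value c x ℤ.+ -1ℤ ℤ.* value d x
      ≡⟨ cong (ℤ._+_ (value c x)) (ℤ.-1*i≡-i (value d x)) ⟩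
    value c x ℤ.- value d x ∎
    where
    open ≡-Reasoning
    expand : ∀ a b z → (a ℤ.- b) ℤ.* z ≡ a ℤ.* z ℤ.+ -1ℤ ℤ.* (b ℤ.* z)
    expand = solve-∀

  residues-injective : ∀ {c d} → residues c ≡ residues d → c ≡ d
  -- Coefficient vectors with equal residues differ by a kernel vector, so `trivial` makes their
  -- digits congruent, hence equal.
  residues-injective {c} {d} eq = finToFun-injective {m} {r} c d λ i →
    ∣toℕ-toℕ⇒≡ (finToFun c i) (finToFun d i)
      (trivial (λ i → coefficient c i ℤ.- coefficient d i)
        (λ x → subst (+ r ∣_) (sym (value-diff c d x)) (%ℕ-≡⇒∣- r (value c x) (value d x) (same-%ℕ x))) i)
    where
    same-residue : residue c ≗ residue d
    same-residue x = trans (sym (finToFun-funToFin (residue c) x))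
      (trans (cong (λ z → finToFun {r} {k} z x) eq) (finToFun-funToFin (residue d) x))

    same-%ℕ : ∀ x → value c x %ℕ r ≡ value d x %ℕ r
    same-%ℕ x = fromℕ<-injective _ _ (n%ℕd<d (value c x) r) (n%ℕd<d (value d x) r) (same-residue x)

-- Since d divides the sum of e, the all-ones matrix may be subtracted from N. Modulo d the result
-- is lower triangular with -1 on the diagonal, so the entries of e vanish one by one, starting from
-- the last.
skewKernel : ∀ {d m} (N : Fin m → Fin m → ℤ) →
  (∀ i → N i i ≡ 0ℤ) → (∀ i j → i <ᶠ j → d ∣ N i j ℤ.- 1ℤ) →
  ∀ e → d ∣ sum e → (∀ j → d ∣ ∑[ i < m ] (e i ℤ.* N i j)) → ∀ j → d ∣ e j
skewKernel {d} {suc m} N diagonal above e d∣∑e d∣∑eN j = go j (>-wellFounded j)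
  where
  go : ∀ j → Acc (λ i k → k <ᶠ i) j → d ∣ e j
  -- The diagonal term `g j` is `e j` times -1; a second factor `-1ℤ` recovers `e j`.
  go j (acc later) = subst (d ∣_) diagonal-term
    (ℤ.∣m⇒∣m*n -1ℤ (ℤ.∣m+n∣n⇒∣m {m = g j}
      (subst (d ∣_) (sum-remove {i = j} g) d∣∑g) (∣-sum _ off-diagonal)))
    where
    g : Fin (suc m) → ℤ
    g i = e i ℤ.* (N i j ℤ.- 1ℤ)

    ∑g : sum g ≡ ∑[ i < suc m ] (e i ℤ.* N i j) ℤ.+ sum e ℤ.* -1ℤ
    ∑g = begin
      sum g
        ≡⟨ sum-cong-≗ (λ i → ℤ.*-distribˡ-+ (e i) (N i j) -1ℤ) ⟩
      ∑[ i < suc m ] (e i ℤ.* N i j ℤ.+ e i ℤ.* -1ℤ)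
        ≡⟨ ∑-distrib-+ (λ i → e i ℤ.* N i j) (λ i → e i ℤ.* -1ℤ) ⟩
      ∑[ i < suc m ] (e i ℤ.* N i j) ℤ.+ ∑[ i < suc m ] (e i ℤ.* -1ℤ)
        ≡⟨ cong (ℤ._+_ (∑[ i < suc m ] (e i ℤ.* N i j))) (*-distribʳ-sum -1ℤ e) ⟨
      ∑[ i < suc m ] (e i ℤ.* N i j) ℤ.+ sum e ℤ.* -1ℤ ∎
      where open ≡-Reasoning

    d∣∑g : d ∣ sum g
    d∣∑g = subst (d ∣_) (sym ∑g) (ℤ.∣m∣n⇒∣m+n (d∣∑eN j) (ℤ.∣m⇒∣m*n -1ℤ d∣∑e))

    off-diagonal : ∀ k → d ∣ g (punchIn j k)
    off-diagonal k with <-cmp (punchIn j k) j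
    ... | tri< i<j _ _ = ℤ.∣n⇒∣m*n (e (punchIn j k)) (above _ j i<j)
    ... | tri≈ _ i≡j _ = contradiction i≡j (punchInᵢ≢i j k)
    ... | tri> _ _ j<i = ℤ.∣m⇒∣m*n _ (go _ (later j<i))

    diagonal-term : g j ℤ.* -1ℤ ≡ e j
    diagonal-term rewrite diagonal j = negate-twice (e j)
      where
      negate-twice : ∀ z → z ℤ.* (0ℤ ℤ.- 1ℤ) ℤ.* -1ℤ ≡ z
      negate-twice = solve-∀

-- Indicators and irrefutable decidability.

module _ {a} {P : Set a} where

  indicator : Dec P → ℤ
  indicator P? = if does P? then 1ℤ else 0ℤ

  indicator-true : (P? : Dec P) → P → indicator P? ≡ 1ℤ
  indicator-true P? p = cong (if_then 1ℤ else 0ℤ) (dec-true P? p)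

  indicator-false : (P? : Dec P) → ¬ P → indicator P? ≡ 0ℤ
  indicator-false P? ¬p = cong (if_then 1ℤ else 0ℤ) (dec-false P? ¬p)

indicator-⇔ : ∀ {a b} {P : Set a} {Q : Set b} → P ⇔ Q →
  (P? : Dec P) (Q? : Dec Q) → indicator P? ≡ indicator Q?
indicator-⇔ P⇔Q P? Q? = cong (if_then 1ℤ else 0ℤ) (does-⇔ P⇔Q P? Q?)

indicator-× : ∀ {a b} {P : Set a} {Q : Set b} (P? : Dec P) (Q? : Dec Q) →
  indicator (P? ×-dec Q?) ≡ indicator P? ℤ.* indicator Q?
indicator-× P? Q? with does P? | does Q?
... | true  | true  = refl
... | true  | false = refl
... | false | true  = refl
... | false | false = refl

-- Each instance of excluded middle is irrefutable, and double negation commutes with finite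
-- products; hence the finite index types.
¬¬-decidable₂ : ∀ {a m k} (P : Fin m → Fin k → Set a) → ¬ ¬ (∀ i x → Dec (P i x))
¬¬-decidable₂ P = sequence ¬¬-applicative (λ i → sequence ¬¬-applicative (λ x → ¬¬-excluded-middle))
  where ¬¬-applicative = RawMonad.rawApplicative ¬¬-Monad

-- Sums over the points of F_q^n, with q = r + 1.

module FieldSums {c ℓ : Level} {r : ℕ} (F : FiniteField c ℓ (suc r)) where

  open FiniteField F hiding (zero; _+_; refl; sym; trans)
  private
    module F = FiniteField F
    module E = Inverse enumeration

  Extensional : ∀ {n} → (Vector Carrier n → ℤ) → Set _
  Extensional f = ∀ {u v} → Pointwise _≈_ u v → f u ≡ f v

  ∷-cong : ∀ {n} {a b : Carrier} {u v : Vector Carrier n} →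
    a ≈ b → Pointwise _≈_ u v → Pointwise _≈_ (a ∷ u) (b ∷ v)
  ∷-cong a≈b u≈v zero    = a≈b
  ∷-cong a≈b u≈v (suc i) = u≈v i

  -- Summing coordinate by coordinate, rather than over `Fin (suc r ^ n)`, allows induction on the
  -- dimension.
  sumPoints : ∀ n → (Vector Carrier n → ℤ) → ℤ
  sumPoints zero    f = f []
  sumPoints (suc n) f = ∑[ i < suc r ] sumPoints n (λ v → f (E.from i ∷ v))

  sumPoints-cong : ∀ n {f g} → f ≗ g → sumPoints n f ≡ sumPoints n g
  sumPoints-cong zero    f≗g = f≗g []
  sumPoints-cong (suc n) f≗g = sum-cong-≗ (λ i → sumPoints-cong n (λ v → f≗g (E.from i ∷ v)))

  ∣-sumPoints : ∀ {d} n f → (∀ v → d ∣ f v) → d ∣ sumPoints n f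
  ∣-sumPoints zero    f d∣f = d∣f []
  ∣-sumPoints (suc n) f d∣f = ∣-sum _ (λ i → ∣-sumPoints n _ (λ v → d∣f (E.from i ∷ v)))

  sumPoints-zero : ∀ n f → (∀ v → f v ≡ 0ℤ) → sumPoints n f ≡ 0ℤ
  sumPoints-zero n f f≡0 =
    ℤ.0∣⇒≡0 (∣-sumPoints n f (λ v → divides 0ℤ (f≡0 v)))

  *-distribˡ-sumPoints : ∀ n x f → x ℤ.* sumPoints n f ≡ sumPoints n (λ v → x ℤ.* f v)
  *-distribˡ-sumPoints zero    x f = refl
  *-distribˡ-sumPoints (suc n) x f = trans
    (*-distribˡ-sum x (λ i → sumPoints n (λ v → f (E.from i ∷ v))))
    (sum-cong-≗ (λ i → *-distribˡ-sumPoints n x (λ v → f (E.from i ∷ v))))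

  sum-sumPoints-comm : ∀ {m} n (f : Fin m → Vector Carrier n → ℤ) →
    ∑[ i < m ] sumPoints n (f i) ≡ sumPoints n (λ v → ∑[ i < m ] f i v)
  sum-sumPoints-comm zero    f = refl
  sum-sumPoints-comm (suc n) f = trans (∑-comm (λ i k → sumPoints n (λ v → f i (E.from k ∷ v))))
    (sum-cong-≗ (λ k → sum-sumPoints-comm n (λ i v → f i (E.from k ∷ v))))

  -- Conjugating π by the enumeration gives a permutation of `Fin (suc r)`, which leaves a finite
  -- sum unchanged.
  sumField-permute : (π : Inverse ≈-setoid ≈-setoid) (g : Carrier → ℤ) →
    (∀ {x y} → x ≈ y → g x ≡ g y) →
    ∑[ i < suc r ] g (Inverse.to π (E.from i)) ≡ ∑[ i < suc r ] g (E.from i)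
  sumField-permute π g g-ext = sym (trans
    (sum-permute (g ∘ E.from) ((flip enumeration ⨾ π) ⨾ enumeration))
    (sum-cong-≗ (λ i → g-ext (E.strictlyInverseʳ (Inverse.to π (E.from i))))))

  -- One bijection per coordinate is general enough, as translations and scalings act
  -- coordinatewise. The tail is permuted first, for each fixed head, and then the head.
  sumPoints-permute : ∀ n (π : Fin n → Inverse ≈-setoid ≈-setoid) f → Extensional f →
    sumPoints n (λ v → f (λ i → Inverse.to (π i) (v i))) ≡ sumPoints n f
  sumPoints-permute zero    π f f-ext = f-ext (λ ())
  sumPoints-permute (suc n) π f f-ext = begin
    ∑[ i < suc r ] sumPoints n (λ v → f (λ j → Inverse.to (π j) ((E.from i ∷ v) j)))
      ≡⟨ sum-cong-≗ (λ i → sumPoints-cong n (λ v → f-ext (apply-∷ (E.from i) v))) ⟩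
    ∑[ i < suc r ] sumPoints n (λ v → f (π₀ (E.from i) ∷ (λ j → Inverse.to (π (suc j)) (v j))))
      ≡⟨ sum-cong-≗ (λ i → sumPoints-permute n (π ∘ suc) (λ v → f (π₀ (E.from i) ∷ v))
           (λ u≈v → f-ext (∷-cong F.refl u≈v))) ⟩
    ∑[ i < suc r ] sumPoints n (λ v → f (π₀ (E.from i) ∷ v))
      ≡⟨ sumField-permute (π zero) (λ a → sumPoints n (λ v → f (a ∷ v)))
           (λ a≈b → sumPoints-cong n (λ v → f-ext (∷-cong a≈b (λ _ → F.refl)))) ⟩
    ∑[ i < suc r ] sumPoints n (λ v → f (E.from i ∷ v)) ∎
    where
    open ≡-Reasoning
    π₀ = Inverse.to (π zero)

    apply-∷ : ∀ a v → Pointwise _≈_ (λ j → Inverse.to (π j) ((a ∷ v) j))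
                                    (π₀ a ∷ (λ j → Inverse.to (π (suc j)) (v j)))
    apply-∷ a v zero    = F.refl
    apply-∷ a v (suc j) = F.refl

  translation : Carrier → Inverse ≈-setoid ≈-setoid
  translation a = record
    { to        = a F.+_
    ; from      = - a F.+_
    ; to-cong   = F.+-congˡ
    ; from-cong = F.+-congˡ
    ; inverse   = (λ {x} eq → F.trans (F.+-congˡ eq) (cancel (F.-‿inverseʳ a)))
                , (λ {x} eq → F.trans (F.+-congˡ eq) (cancel (F.-‿inverseˡ a)))
    }
    where
    cancel : ∀ {b c x} → b F.+ c ≈ 0# → b F.+ (c F.+ x) ≈ x
    cancel {b} {c} {x} bc≈0 =
      F.trans (F.sym (F.+-assoc b c x)) (F.trans (F.+-congʳ bc≈0) (F.+-identityˡ x))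

  scaling : ∀ a b → a * b ≈ 1# → Inverse ≈-setoid ≈-setoid
  scaling a b ab≈1 = record
    { to        = a *_
    ; from      = b *_
    ; to-cong   = *-congˡ
    ; from-cong = *-congˡ
    ; inverse   = (λ eq → F.trans (*-congˡ eq) (cancel ab≈1))
                , (λ eq → F.trans (*-congˡ eq) (cancel (F.trans (*-comm b a) ab≈1)))
    }
    where
    cancel : ∀ {b c x} → b * c ≈ 1# → b * (c * x) ≈ x
    cancel {b} {c} {x} bc≈1 =
      F.trans (F.sym (*-assoc b c x)) (F.trans (*-congʳ bc≈1) (*-identityˡ x))

  -- Homogeneity of degree 0: constancy on each punctured line through the origin.
  Homogeneous : ∀ {n} → (Vector Carrier n → ℤ) → Set _
  Homogeneous f = ∀ t → ¬ t ≈ 0# → ∀ v → f (map (t *_) v) ≡ f v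

  -- The slices of f at nonzero first coordinates are rescalings of one another,
  -- so all r of them have the same sum.
  sumPoints-homogeneous : ∀ n f → Extensional f → Homogeneous f →
    + r ∣ sumPoints n f ℤ.- f (replicate n 0#)
  sumPoints-homogeneous zero    f f-ext f-hom =
    divides 0ℤ (ℤ.i≡j⇒i-j≡0 (f-ext (λ ())))
  sumPoints-homogeneous (suc n) f f-ext f-hom =
    -- By induction the slice at 0 is congruent to the value at the origin; the other r slices
    -- contribute r times `slice 1#`.
    subst (+ r ∣_) (sym split) (ℤ.∣m∣n⇒∣m+n
      (sumPoints-homogeneous n (λ v → f (0# ∷ v)) (λ u≈v → f-ext (∷-cong F.refl u≈v)) slice₀-hom)
      (divides (slice 1#) (ℤ.*-comm (+ r) (slice 1#))))
    where
    open ≡-Reasoning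
    slice : Carrier → ℤ
    slice a = sumPoints n (λ v → f (a ∷ v))

    slice-cong : ∀ {a b} → a ≈ b → slice a ≡ slice b
    slice-cong a≈b = sumPoints-cong n (λ v → f-ext (∷-cong a≈b (λ _ → F.refl)))

    slice₀-hom : Homogeneous (λ v → f (0# ∷ v))
    slice₀-hom t t≉0 v = trans
      (f-ext (λ { zero → F.sym (zeroʳ t) ; (suc i) → F.refl }))
      (f-hom t t≉0 (0# ∷ v))

    slice-nonzero : ∀ t → ¬ t ≈ 0# → slice t ≡ slice 1#
    -- Replacing v by t v turns the argument into t times (1, v), and homogeneity removes the factor
    -- t.
    slice-nonzero t t≉0 = begin
      slice t
        ≡⟨ sumPoints-permute n (λ _ → scaling t (proj₁ (inverse t t≉0)) (proj₂ (inverse t t≉0)))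
             (λ v → f (t ∷ v)) (λ u≈v → f-ext (∷-cong F.refl u≈v)) ⟨
      sumPoints n (λ v → f (t ∷ map (t *_) v))
        ≡⟨ sumPoints-cong n (λ v →
             f-ext (λ { zero → F.sym (*-identityʳ t) ; (suc i) → F.refl })) ⟩
      sumPoints n (λ v → f (map (t *_) (1# ∷ v)))
        ≡⟨ sumPoints-cong n (λ v → f-hom t t≉0 (1# ∷ v)) ⟩
      slice 1# ∎

    -- Removing the index of `0#` leaves exactly r indices, the source of the modulus.
    i₀ = E.to 0#

    from-punchIn≉0 : ∀ k → ¬ E.from (punchIn i₀ k) ≈ 0#
    from-punchIn≉0 k eq =
      punchInᵢ≢i i₀ k (trans (sym (E.strictlyInverseˡ (punchIn i₀ k))) (E.to-cong eq))

    sum-slices : sumPoints (suc n) f ≡ slice 0# ℤ.+ + r ℤ.* slice 1#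
    sum-slices = begin
      ∑[ i < suc r ] slice (E.from i)
        ≡⟨ sum-remove {i = i₀} (slice ∘ E.from) ⟩
      slice (E.from i₀) ℤ.+ ∑[ k < r ] slice (E.from (punchIn i₀ k))
        ≡⟨ cong₂ ℤ._+_ (slice-cong (E.strictlyInverseʳ 0#))
             (trans (sum-cong-≗ (λ k → slice-nonzero _ (from-punchIn≉0 k))) (sum-const r (slice 1#))) ⟩
      slice 0# ℤ.+ + r ℤ.* slice 1# ∎

    split : sumPoints (suc n) f ℤ.- f (replicate (suc n) 0#) ≡
            (slice 0# ℤ.- f (0# ∷ replicate n 0#)) ℤ.+ + r ℤ.* slice 1#
    split = begin
      sumPoints (suc n) f ℤ.- f (replicate (suc n) 0#)
        ≡⟨ cong₂ ℤ._-_ sum-slices (f-ext (λ { zero → F.refl ; (suc i) → F.refl })) ⟩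
      (slice 0# ℤ.+ + r ℤ.* slice 1#) ℤ.- f (0# ∷ replicate n 0#)
        ≡⟨ swap (slice 0#) (+ r ℤ.* slice 1#) _ ⟩
      (slice 0# ℤ.- f (0# ∷ replicate n 0#)) ℤ.+ + r ℤ.* slice 1# ∎
      where
      swap : ∀ x y z → (x ℤ.+ y) ℤ.- z ≡ (x ℤ.- z) ℤ.+ y
      swap = solve-∀

  pointAt : ∀ {n} → Fin (suc r ^ n) → Vector Carrier n
  pointAt x i = E.from (finToFun x i)

  indexOf : ∀ {n} → Vector Carrier n → Fin (suc r ^ n)
  indexOf v = funToFin (E.to ∘ v)

  pointAt-indexOf : ∀ {n} (v : Vector Carrier n) → Pointwise _≈_ (pointAt (indexOf v)) v
  pointAt-indexOf v i = E.inverseʳ (finToFun-funToFin (E.to ∘ v) i)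

-- Affine subspaces and the sizes of their intersections.

module AffineSubspaces {c ℓ : Level} {r : ℕ} (F : FiniteField c ℓ (suc r)) (n : ℕ) where

  open FiniteField F hiding (zero; _+_; refl; sym; trans)
  open AffineGeometry F n
  open FieldSums F
  private module F = FiniteField F

  points-resp : ∀ {p} (S : AffineSubspace p) {v w} → v ≈ᵥ w → points S v → points S w
  points-resp S v≈w (u , u∈U , v≈b+u) = u , u∈U , λ i → F.trans (F.sym (v≈w i)) (v≈b+u i)

  -- Cancelling the base gives u = u₁ - u₀, a vector of the direction, so w + t u is the base plus
  -- u₀ + t (u₁ - u₀).
  homothety-closed : ∀ {p} (S : AffineSubspace p) {w u} t →
    points S w → points S (w +ᵥ u) → points S (w +ᵥ t ·ᵥ u)
  homothety-closed S {w} {u} t (u₀ , u₀∈U , w≈) (u₁ , u₁∈U , w+u≈) =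
    u₀ +ᵥ t ·ᵥ (u₁ +ᵥ (- 1#) ·ᵥ u₀) ,
    +-closed u₀∈U (·-closed t (+-closed u₁∈U (·-closed (- 1#) u₀∈U))) ,
    λ i → F.trans (F.+-cong (w≈ i) (*-congˡ (u≈ i))) (F.+-assoc (base i) (u₀ i) _)
    where
    open AffineGeometry.AffineSubspace S using (base; direction)
    open LinearSubspace direction
    u₀+u≈u₁ : ∀ i → u₀ i F.+ u i ≈ u₁ i
    u₀+u≈u₁ i = +-cancelˡ ring (base i) _ _
      (F.trans (F.sym (F.+-assoc (base i) (u₀ i) (u i)))
        (F.trans (F.+-congʳ (F.sym (w≈ i))) (w+u≈ i)))

    u≈ : ∀ i → u i ≈ u₁ i F.+ (- 1#) * u₀ i
    u≈ i = F.trans (F.sym (xyx⁻¹≈y +-abelianGroup (u₀ i) (u i)))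
      (F.+-cong (u₀+u≈u₁ i) (F.sym (-1*x≈-x ring (u₀ i))))

  -- The forward direction is the homothety of ratio t⁻¹ applied to t u. It follows that the
  -- indicator of S, recentred at a point of S, is homogeneous.
  homothety-⇔ : ∀ {p} (S : AffineSubspace p) {w u} t → ¬ t ≈ 0# → points S w →
    points S (w +ᵥ t ·ᵥ u) ⇔ points S (w +ᵥ u)
  homothety-⇔ S {w} {u} t t≉0 w∈S = mk⇔
    (λ tu∈S → points-resp S
      (λ i → F.+-congˡ (F.trans (F.sym (*-assoc s t (u i)))
        (F.trans (*-congʳ st≈1) (*-identityˡ (u i)))))
      (homothety-closed S s w∈S tu∈S))
    (homothety-closed S t w∈S)
    where
    s = proj₁ (inverse t t≉0)
    st≈1 : s * t ≈ 1#
    st≈1 = F.trans (*-comm s t) (proj₂ (inverse t t≉0))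

  -- Every point is `≈ᵥ` to a numbered one, so finitely many decisions settle membership everywhere.
  points? : ∀ {p} (S : AffineSubspace p) → (∀ x → Dec (points S (pointAt x))) →
    ∀ w → Dec (points S w)
  points? S S? w = map′ (points-resp S (pointAt-indexOf w))
    (points-resp S (λ i → F.sym (pointAt-indexOf w i))) (S? (indexOf w))

  module _ {a b : Level} (S : AffineSubspace a) (T : AffineSubspace b)
           (S? : ∀ w → Dec (points S w)) (T? : ∀ w → Dec (points T w)) where

    -- As a sum of products it is linear in the indicator of S for fixed T, which `∑eN` exploits.
    intersectionSize : ℤ
    intersectionSize = sumPoints n (λ w → indicator (S? w) ℤ.* indicator (T? w))

    disjoint⇒size≡0 : Empty (points S ∩ points T) → intersectionSize ≡ 0ℤ
    disjoint⇒size≡0 empty = sumPoints-zero n _ λ w →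
      trans (sym (indicator-× (S? w) (T? w))) (indicator-false (S? w ×-dec T? w) (empty w))

    -- Moving the origin to a common point w makes the indicator of the intersection homogeneous
    -- with value 1 at the origin, so `sumPoints-homogeneous` applies.
    meeting⇒size≡1 : Satisfiable (points S ∩ points T) → + r ∣ intersectionSize ℤ.- 1ℤ
    meeting⇒size≡1 (w , w∈S , w∈T) = subst (+ r ∣_)
      (cong₂ ℤ._-_ size≡ (indicator-true (both? 0ᵥ) (at0 S w∈S , at0 T w∈T)))
      (sumPoints-homogeneous n f f-ext f-hom)
      where
      open ≡-Reasoning
      both? : ∀ u → Dec (points S (w +ᵥ u) × points T (w +ᵥ u))
      both? u = S? (w +ᵥ u) ×-dec T? (w +ᵥ u)

      f : Point → ℤ
      f u = indicator (both? u)

      at0 : ∀ {p} (R : AffineSubspace p) → points R w → points R (w +ᵥ 0ᵥ)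
      at0 R = points-resp R (λ i → F.sym (F.+-identityʳ (w i)))

      both-resp : ∀ {u v} → u ≈ᵥ v →
        points S u × points T u → points S v × points T v
      both-resp u≈v (s , t) = points-resp S u≈v s , points-resp T u≈v t

      f-ext : Extensional f
      f-ext {u} {v} u≈v = indicator-⇔
        (mk⇔ (both-resp (λ i → F.+-congˡ (u≈v i))) (both-resp (λ i → F.+-congˡ (F.sym (u≈v i)))))
        (both? u) (both? v)

      f-hom : Homogeneous f
      f-hom t t≉0 u = indicator-⇔
        (homothety-⇔ S t t≉0 w∈S ×-⇔ homothety-⇔ T t t≉0 w∈T)
        (both? (t ·ᵥ u)) (both? u)

      size≡ : sumPoints n f ≡ intersectionSize
      size≡ = begin
        sumPoints n f
          ≡⟨ sumPoints-permute n (translation ∘ w) (λ v → indicator (S? v ×-dec T? v))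
               (λ {u} {v} u≈v → indicator-⇔
                 (mk⇔ (both-resp u≈v) (both-resp (λ i → F.sym (u≈v i))))
                 (S? u ×-dec T? u) (S? v ×-dec T? v)) ⟩
        sumPoints n (λ v → indicator (S? v ×-dec T? v))
          ≡⟨ sumPoints-cong n (λ v → indicator-× (S? v) (T? v)) ⟩
        intersectionSize ∎

  skewPairs-bound-dec : ∀ {a b} → 1 < r →
    (m : ℕ) (A : Fin m → AffineSubspace a) (B : Fin m → AffineSubspace b) →
    (∀ i x → Dec (points (A i) (pointAt x))) → (∀ i x → Dec (points (B i) (pointAt x))) →
    (∀ i → Empty (points (A i) ∩ points (B i))) →
    (∀ i j → i <ᶠ j → Satisfiable (points (A i) ∩ points (B j))) →
    m ≤ suc (suc r ^ n)
  skewPairs-bound-dec 1<r m A B A?ᵖ B?ᵖ disjoint meeting =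
    -- For e in the kernel of `X`, row `zero` shows that r divides the sum of e, and the remaining
    -- rows that r divides every entry of e N.
    trivialKernel⇒≤ r {{ℕ.>-nonZero (ℕ.<-trans z<s 1<r)}} 1<r X λ e r∣X →
      skewKernel N
        (λ i → disjoint⇒size≡0 (A i) (B i) (A? i) (B? i) (disjoint i))
        (λ i j i<j → meeting⇒size≡1 (A i) (B j) (A? i) (B? j) (meeting i j i<j))
        e
        (subst (+ r ∣_) (sum-cong-≗ (λ i → ℤ.*-identityʳ (e i))) (r∣X zero))
        (λ j → subst (+ r ∣_) (sym (∑eN e j)) (∣-sumPoints n _ (λ w →
          ℤ.∣m⇒∣m*n (indicator (B? j w)) (at-point e r∣X w))))
    where
    A? : ∀ i w → Dec (points (A i) w)
    A? i = points? (A i) (A?ᵖ i)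

    B? : ∀ i w → Dec (points (B i) w)
    B? i = points? (B i) (B?ᵖ i)

    N : Fin m → Fin m → ℤ
    N i j = intersectionSize (A i) (B j) (A? i) (B? j)

    -- The row of ones accounts for the + 1 in the bound; the other rows form the incidence matrix
    -- of points and the A_i.
    X : Fin (suc (suc r ^ n)) → Fin m → ℤ
    X zero    i = 1ℤ
    X (suc x) i = indicator (A? i (pointAt x))

    -- `sumPoints` evaluates at vectors built by `∷`, not at values of `pointAt`, so the congruence
    -- is carried over to all points.
    at-point : ∀ e → (∀ x → + r ∣ ∑[ i < m ] (e i ℤ.* X x i)) →
      ∀ w → + r ∣ ∑[ i < m ] (e i ℤ.* indicator (A? i w))
    at-point e r∣X w = subst (+ r ∣_)
      (sum-cong-≗ (λ i → cong (ℤ._*_ (e i)) (indicator-⇔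
        (mk⇔ (points-resp (A i) (pointAt-indexOf w))
             (points-resp (A i) (λ k → F.sym (pointAt-indexOf w k))))
        (A? i (pointAt (indexOf w))) (A? i w))))
      (r∣X (suc (indexOf w)))

    -- Exchanging the sums factors N through the points of W, so e enters only through the values Σ
    -- e_i [w ∈ A_i].
    ∑eN : ∀ e j → ∑[ i < m ] (e i ℤ.* N i j) ≡
      sumPoints n (λ w → ∑[ i < m ] (e i ℤ.* indicator (A? i w)) ℤ.* indicator (B? j w))
    ∑eN e j = begin
      ∑[ i < m ] (e i ℤ.* N i j)
        ≡⟨ sum-cong-≗ (λ i → *-distribˡ-sumPoints n (e i)
             (λ w → indicator (A? i w) ℤ.* indicator (B? j w))) ⟩
      ∑[ i < m ] sumPoints n (λ w → e i ℤ.* (indicator (A? i w) ℤ.* indicator (B? j w)))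
        ≡⟨ sum-sumPoints-comm n (λ i w → e i ℤ.* (indicator (A? i w) ℤ.* indicator (B? j w))) ⟩
      sumPoints n (λ w → ∑[ i < m ] (e i ℤ.* (indicator (A? i w) ℤ.* indicator (B? j w))))
        ≡⟨ sumPoints-cong n (λ w → trans
             (sum-cong-≗ (λ i → sym (ℤ.*-assoc (e i) (indicator (A? i w)) (indicator (B? j w)))))
             (sym (*-distribʳ-sum (indicator (B? j w)) (λ i → e i ℤ.* indicator (A? i w))))) ⟩
      sumPoints n (λ w → ∑[ i < m ] (e i ℤ.* indicator (A? i w)) ℤ.* indicator (B? j w)) ∎
      where open ≡-Reasoning

  -- The bound is decidable, so membership may be assumed decidable at the
  -- finitely many points and pairs involved.
  skewPairs-bound : ∀ {a b} → 1 < r →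
    (m : ℕ) (A : Fin m → AffineSubspace a) (B : Fin m → AffineSubspace b) →
    (∀ i → Empty (points (A i) ∩ points (B i))) →
    (∀ i j → i <ᶠ j → Satisfiable (points (A i) ∩ points (B j))) →
    m ≤ suc (suc r ^ n)
  skewPairs-bound 1<r m A B disjoint meeting =
    decidable-stable (m ℕ.≤? suc (suc r ^ n)) λ m≰ →
      ¬¬-decidable₂ (λ i x → points (A i) (pointAt x)) λ A? →
      ¬¬-decidable₂ (λ i x → points (B i) (pointAt x)) λ B? →
      m≰ (skewPairs-bound-dec 1<r m A B A? B? disjoint meeting)

-- The bound, by cases on the order of the field.

theorem1p4 : ∀ {c ℓ a b : Level} (q : ℕ) → PrimePower q → q ≢ 2 →
    (F : FiniteField c ℓ q) (n : ℕ) → 1 ≤ n →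
    let open AffineGeometry F n in
    (m : ℕ) (A : Fin m → AffineSubspace a) (B : Fin m → AffineSubspace b) →
    (∀ i → Empty (points (A i) ∩ points (B i))) →
    (∀ i j → i <ᶠ j → Satisfiable (points (A i) ∩ points (B j))) →
    m ≤ q ^ n + 1
-- No field has order 0 or 1: `Fin 0` has no index for `0#`, and `Fin 1` would identify `1#` with
-- `0#`.
theorem1p4 zero _ _ F _ _ _ _ _ _ _ = contradiction (Inverse.to enumeration 0#) λ ()
  where open FiniteField F using (enumeration; 0#)
theorem1p4 (suc zero) _ _ F _ _ _ _ _ _ _ = contradiction
  (F.trans (F.sym (E.strictlyInverseʳ F.1#)) (E.inverseʳ (Fin1-unique (E.to F.1#) (E.to F.0#))))
  F.1≉0
  where
  module F = FiniteField F
  module E = Inverse F.enumeration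
  Fin1-unique : (x y : Fin 1) → x ≡ y
  Fin1-unique zero zero = refl
-- For q = 2 the modulus r would be 1 and all congruences void; from q = 3 on, r is at least 2.
theorem1p4 (suc (suc zero)) _ q≢2 _ _ _ _ _ _ _ _ = contradiction refl q≢2
theorem1p4 (suc r@(suc (suc _))) _ _ F n _ m A B disjoint meeting =
  subst (m ≤_) (ℕ.+-comm 1 (suc r ^ n))
    (AffineSubspaces.skewPairs-bound F n (s<s z<s) m A B disjoint meeting)
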